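{- For every integer $n\ge3$, $$H(n+1)>H(n).$$
   Context: $p(n)$ denotes the number of (unrestricted) partitions of the positive integer $n$, and $H(n):=p(n)-n$. -}

module Defs where

open import Data.Empty using (⊥)
open import Data.Fin.Base using (Fin; zero; suc)
open import Data.Integer.Base as ℤ using (ℤ; +_)
open import Data.List.Base
  using (List; []; _∷_; length; lookup; filter; upTo; cartesianProductWith)
open import Data.List.Membership.Propositional using (_∈_)
open import Data.List.Membership.Propositional.Properties
  using (∈-filter⁺; ∈-filter⁻; ∈-lookup; ∈-upTo⁺; ∈-cartesianProductWith⁺; ∈-cartesianProductWith⁻)
open import Data.List.Properties using (∷-injective)
open import Data.List.Relation.Unary.All as All using (All; []; _∷_)
open import Data.List.Relation.Unary.AllPairs using ([]; _∷_)
open import Data.List.Relation.Unary.Any using (here; there; index)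
open import Data.List.Relation.Unary.Any.Properties using (lookup-index)
open import Data.List.Relation.Unary.Linked as Linked using (Linked; linked?)
open import Data.List.Relation.Unary.Unique.Propositional using (Unique)
import Data.List.Relation.Unary.Unique.Propositional.Properties as Unique
open import Data.Nat.Base using (ℕ; zero; suc; _+_; _≤_; _<_; _≥_; s≤s; z≤n)
open import Data.Nat.ListAction using (sum)
open import Data.Nat.Properties
  using (_≟_; _≥?_; _<?_; ≤-irrelevant; ≡-irrelevant; ≤-trans;
         +-mono-≤; m≤m+n; m≤n+m)
open import Data.Product.Base using (Σ; _×_; _,_; proj₁; proj₂)
open import Function.Base using (_∘_)
open import Function.Bundles using (_↔_; mk↔ₛ′)
open import Relation.Binary.PropositionalEquality
  using (_≡_; refl; sym; cong; cong₂)
open import Relation.Nullary using (contradiction; _×-dec_)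
open import Relation.Unary using (Decidable; Irrelevant)

IsPartition : ℕ → List ℕ → Set
IsPartition n xs = Linked _≥_ xs × All (0 <_) xs × sum xs ≡ n

Partition : ℕ → Set
Partition n = Σ (List ℕ) (IsPartition n)

isPartition? : ∀ n → Decidable (IsPartition n)
isPartition? n xs = linked? _≥?_ xs ×-dec All.all? (0 <?_) xs ×-dec (sum xs ≟ n)

boundedLists : ℕ → ℕ → List (List ℕ)
boundedLists m zero    = [] ∷ []
boundedLists m (suc k) = [] ∷ cartesianProductWith _∷_ (upTo (suc m)) (boundedLists m k)

-- boundedLists n n has the lists of length ≤ n with entries ≤ n.
-- A partition of n has at most n parts, each at most n, so none is missed.
partitions : ℕ → List (List ℕ)
partitions n = filter (isPartition? n) (boundedLists n n)

p : ℕ → ℕ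
p n = length (partitions n)

-- The difference is taken in ℤ, so nothing is truncated.
H : ℕ → ℤ
H n = + p n ℤ.- + n

-- The remainder shows that p n is the cardinality of Partition n.

boundedLists-unique : ∀ m k → Unique (boundedLists m k)
boundedLists-unique m zero    = [] ∷ []
boundedLists-unique m (suc k) =
  All.tabulate (λ xs∈ → λ { refl → nonempty xs∈ }) ∷
  Unique.cartesianProductWith⁺ _∷_ ∷-injective (Unique.upTo⁺ (suc m)) (boundedLists-unique m k)
  where
  nonempty : [] ∈ cartesianProductWith _∷_ (upTo (suc m)) (boundedLists m k) → ⊥
  nonempty []∈ with () ← proj₂ (proj₂ (proj₂ (proj₂
    (∈-cartesianProductWith⁻ _∷_ (upTo (suc m)) (boundedLists m k) []∈))))

partitions-unique : ∀ n → Unique (partitions n)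
partitions-unique n = Unique.filter⁺ (isPartition? n) (boundedLists-unique n n)

boundedLists-complete : ∀ {m k} xs → length xs ≤ k → All (_≤ m) xs → xs ∈ boundedLists m k
boundedLists-complete {k = zero}  []       _         _          = here refl
boundedLists-complete {k = suc k} []       _         _          = here refl
boundedLists-complete {k = suc k} (x ∷ xs) (s≤s len) (x≤m ∷ bd) =
  there (∈-cartesianProductWith⁺ _∷_ (∈-upTo⁺ (s≤s x≤m)) (boundedLists-complete xs len bd))

length≤sum : ∀ {xs} → All (0 <_) xs → length xs ≤ sum xs
length≤sum []         = z≤n
length≤sum (0<x ∷ ps) = +-mono-≤ 0<x (length≤sum ps)

parts≤sum : ∀ xs → All (_≤ sum xs) xs
parts≤sum []       = []
parts≤sum (x ∷ xs) =
  m≤m+n x (sum xs) ∷ All.map (λ y≤ → ≤-trans y≤ (m≤n+m (sum xs) x)) (parts≤sum xs)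

partitions-complete : ∀ {n xs} → IsPartition n xs → xs ∈ partitions n
partitions-complete {xs = xs} π@(_ , pos , refl) =
  ∈-filter⁺ (isPartition? _) (boundedLists-complete xs (length≤sum pos) (parts≤sum xs)) π

partitions-sound : ∀ {n xs} → xs ∈ partitions n → IsPartition n xs
partitions-sound {n} = proj₂ ∘ ∈-filter⁻ (isPartition? n) {xs = boundedLists n n}

isPartition-irrelevant : ∀ {n} → Irrelevant (IsPartition n)
isPartition-irrelevant (d , a , s) (d′ , a′ , s′) =
  cong₂ _,_ (Linked.irrelevant ≤-irrelevant d d′)
            (cong₂ _,_ (All.irrelevant ≤-irrelevant a a′) (≡-irrelevant s s′))

partition-≡ : ∀ {n} {π ρ : Partition n} → proj₁ π ≡ proj₁ ρ → π ≡ ρ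
partition-≡ {π = xs , h} {ρ = .xs , h′} refl = cong (xs ,_) (isPartition-irrelevant h h′)

lookup-injective : ∀ {A : Set} {xs : List A} → Unique xs →
                   ∀ i j → lookup xs i ≡ lookup xs j → i ≡ j
lookup-injective (_ ∷ _)  zero    zero    _  = refl
lookup-injective (x∉ ∷ _) zero    (suc j) eq = contradiction eq (All.lookup x∉ (∈-lookup j))
lookup-injective (x∉ ∷ _) (suc i) zero    eq = contradiction (sym eq) (All.lookup x∉ (∈-lookup i))
lookup-injective (_ ∷ u)  (suc i) (suc j) eq = cong suc (lookup-injective u i j eq)

Partition↔Fin : ∀ n → Partition n ↔ Fin (p n)
Partition↔Fin n = mk↔ₛ′ to from
  (λ i → lookup-injective (partitions-unique n) _ _ (lookup-to (from i)))
  (λ π → partition-≡ (lookup-to π))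
  where
  to : Partition n → Fin (p n)
  to (_ , h) = index (partitions-complete h)

  from : Fin (p n) → Partition n
  from i = lookup (partitions n) i , partitions-sound (∈-lookup i)

  lookup-to : ∀ π → lookup (partitions n) (to π) ≡ proj₁ π
  lookup-to (_ , h) = sym (lookup-index (partitions-complete h))

{-# OPTIONS --safe #-}

-- Appending a part 1 injects the partitions of n into those of n + 1.  For
-- n ≥ 3 it misses both n + 1 = (n + 1) and n + 1 = (n - 1) + 2, whose last
-- part is not 1, so p (n + 1) ≥ p n + 2.

module Submission where

open import Defs
open import Data.Nat.Base using (ℕ; _+_; _≥_)
open import Data.Integer.Base using (_>_)

open import Data.Fin.Properties using (injective⇒≤)
open import Data.Integer.Base using (_⊖_)
import Data.Integer.Properties as ℤ
open import Data.List.Base using (List; []; _∷_; [_]; _∷ʳ_; length; lookup; map)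
open import Data.List.Membership.Propositional.Properties using (∈-lookup; ∈-map⁻)
open import Data.List.Properties using (length-map; ∷ʳ-injectiveˡ; ∷ʳ-injectiveʳ)
open import Data.List.Relation.Binary.Subset.Propositional using (_⊆_)
open import Data.List.Relation.Unary.All as All using (All; []; _∷_)
import Data.List.Relation.Unary.All.Properties as All
open import Data.List.Relation.Unary.AllPairs using ([]; _∷_)
open import Data.List.Relation.Unary.Any using (here; there; index)
open import Data.List.Relation.Unary.Any.Properties using (lookup-index)
open import Data.List.Relation.Unary.Linked using (Linked; []; [-]; _∷_)
open import Data.List.Relation.Unary.Unique.Propositional using (Unique)
import Data.List.Relation.Unary.Unique.Propositional.Properties as Unique
open import Data.Nat.Base using (suc; _≤_; s≤s; z<s)
open import Data.Nat.ListAction using (sum)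
open import Data.Nat.ListAction.Properties using (sum-++)
open import Data.Nat.Properties using (+-comm; +-identityʳ; <-≤-trans)
open import Data.Product.Base using (_,_)
open import Relation.Binary.PropositionalEquality
  using (_≡_; _≢_; refl; trans; cong; subst; module ≡-Reasoning)

-- Since `H (n + 1) - H n` is `p (n + 1) - p n - 1`, it must be shown that `p` gains at least 2. The
-- two extra partitions and the image of appending a 1 form a duplicate-free list of `2 + p n`
-- partitions of `n + 1`; by pigeonhole (`Unique-⊆⇒length≤`) it is no longer than
-- `partitions (suc n)`.

-- Sending a position in `xs` to a position of the same entry in `ys` is injective, because `xs` has
-- no repeats.
Unique-⊆⇒length≤ : ∀ {A : Set} {xs ys : List A} → Unique xs → xs ⊆ ys → length xs ≤ length ys
Unique-⊆⇒length≤ {xs = xs} {ys} xs! xs⊆ys = injective⇒≤ λ {i} {j} eq →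
  lookup-injective xs! i j (begin
    lookup xs i                               ≡⟨ lookup-index (xs⊆ys (∈-lookup i)) ⟩
    lookup ys (index (xs⊆ys (∈-lookup i)))    ≡⟨ cong (lookup ys) eq ⟩
    lookup ys (index (xs⊆ys (∈-lookup j)))    ≡⟨ lookup-index (xs⊆ys (∈-lookup j)) ⟨
    lookup xs j                               ∎)
  where
  open ≡-Reasoning

∷ʳ-Linked-≥ : ∀ {x xs} → Linked _≥_ xs → All (x ≤_) xs → Linked _≥_ (xs ∷ʳ x)
∷ʳ-Linked-≥ []         []          = [-]
∷ʳ-Linked-≥ [-]        (x≤y ∷ [])  = x≤y ∷ [-]
∷ʳ-Linked-≥ (y≥z ∷ zs) (_ ∷ x≤zs)  = y≥z ∷ ∷ʳ-Linked-≥ zs x≤zs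

∷ʳ1-isPartition : ∀ {n xs} → IsPartition n xs → IsPartition (suc n) (xs ∷ʳ 1)
∷ʳ1-isPartition {xs = xs} (desc , pos , refl) =
  -- `0 < y` unfolds to `1 ≤ y`, so positivity of the parts is already the bound needed to append 1.
  ∷ʳ-Linked-≥ desc pos , All.∷ʳ⁺ pos z<s , trans (sum-++ xs [ 1 ]) (+-comm (sum xs) 1)

-- Keeps the two extra partitions, whose last parts differ from 1, out of the image of `_∷ʳ 1`.
last≢⇒∉map-∷ʳ : ∀ {A : Set} {x y : A} {xs xss} → y ≢ x → All (xs ∷ʳ y ≢_) (map (_∷ʳ x) xss)
last≢⇒∉map-∷ʳ {xs = xs} y≢x =
  All.map⁺ (All.tabulate λ {zs} _ eq → y≢x (∷ʳ-injectiveʳ xs zs eq))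

2+p≤p-suc : ∀ n → n ≥ 3 → 2 + p n ≤ p (suc n)
2+p≤p-suc n@(suc m) (s≤s 2≤m) =
  subst (λ l → 2 + l ≤ p (suc n)) (length-map (_∷ʳ 1) (partitions n))
    (Unique-⊆⇒length≤ distinct valid)
  where
  found : List (List ℕ)
  found = [ suc n ] ∷ (m ∷ 2 ∷ []) ∷ map (_∷ʳ 1) (partitions n)

  distinct : Unique found
  distinct =
    -- The two extra partitions differ in length; the last part of the first is `suc (suc m)`,
    -- visibly not 1.
    ((λ ()) ∷ last≢⇒∉map-∷ʳ {xs = []} (λ ())) ∷
    last≢⇒∉map-∷ʳ {xs = [ m ]} (λ ()) ∷
    Unique.map⁺ (∷ʳ-injectiveˡ _ _) (partitions-unique n)

  valid : found ⊆ partitions (suc n)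
  valid (here refl) = partitions-complete {suc n} ([-] , z<s ∷ [] , +-identityʳ (suc n))
  valid (there (here refl)) =
    -- Here `n ≥ 3` enters: `m`, which is `n - 1`, must be at least 2 for the parts `m`, 2 to be in
    -- order.
    partitions-complete {suc n} (2≤m ∷ [-] , <-≤-trans z<s 2≤m ∷ z<s ∷ [] , +-comm m 2)
  valid (there (there xs∈)) with _ , ys∈ , refl ← ∈-map⁻ (_∷ʳ 1) xs∈ =
    partitions-complete {suc n} (∷ʳ1-isPartition (partitions-sound {n} ys∈))

theorem3p2 : (n : ℕ) → n ≥ 3 → H (n + 1) > H n
theorem3p2 n n≥3 rewrite +-comm n 1 = begin-strict
  H n                  ≡⟨ ℤ.m-n≡m⊖n (p n) n ⟩
  p n ⊖ n              ≡⟨ ℤ.[1+m]⊖[1+n]≡m⊖n (p n) n ⟨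
  -- `suc (p n) < p (suc n)` unfolds to `2 + p n ≤ p (suc n)`.
  suc (p n) ⊖ suc n    <⟨ ℤ.⊖-monoˡ-< (suc n) (2+p≤p-suc n n≥3) ⟩
  p (suc n) ⊖ suc n    ≡⟨ ℤ.m-n≡m⊖n (p (suc n)) (suc n) ⟨
  H (suc n)            ∎
  where open ℤ.≤-Reasoning
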